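{- Let $n\ge1$. There is a bijection $$\phi:\mathcal{D}_{2n}\to\{f\in\mathcal{E}_{2n+2}: f\text{ has no even maxima}\}$$ such that for all $\sigma\in\mathcal{D}_{2n}$ and $j\in[2n]$ the following hold: (1) $j$ is an even cycle maximum of $\sigma$ if and only if $j$ is a fixed point of $\phi(\sigma)$; (2) $j$ is an even fixed point of $\sigma$ if and only if $j$ is an isolated fixed point of $\phi(\sigma)$; (3) $j$ is an odd fixed point of $\sigma$ if and only if $j$ is an odd maximum of $\phi(\sigma)$.
   Context: $[m]=\{1,\dots,m\}$. $\mathcal{D}_{2n}$ is the set of D-permutations on $[2n]$: permutations $\sigma$ of $[2n]$ such that $i\le\sigma(i)$ whenever $i$ is odd and $i\ge\sigma(i)$ whenever $i$ is even. A cycle maximum of $\sigma$ is an element that is the largest element of its cycle (fixed points being cycles of length 1). An excedent function on $[m]$ is a map $f:[m]\to[m]$ with $f(i)\ge i$ for all $i$. $\mathcal{E}_{2m}$ is the set of surjective staircases on $[2m]$: excedent functions $f:[2m]\to[2m]$ whose image is exactly $\{2,4,\dots,2m\}$. For an excedent function $f$, a fixed point is a $j$ with $f(j)=j$; it is isolated if $f^{ -1}(j)=\{j\}$. For $f\in\mathcal{E}_{2m}$, a maximum of $f$ is a $j\in[2m-2]$ with $f(j)=2m$; it is an even (odd) maximum if $j$ is even (odd). -}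

module Defs where

open import Data.Fin.Base using (Fin; toℕ; inject₁)
open import Data.Fin.Permutation as Perm using (Permutation′; _⟨$⟩ʳ_)
open import Data.Nat.Base using (ℕ; suc; _*_; _∸_; _≤_)
open import Data.Nat.Divisibility using (_∣_)
open import Data.Nat.GeneralisedArithmetic using (iterate)
open import Data.Product.Base using (Σ; ∃; _×_; proj₁)
open import Function.Bundles using (_⇔_)
open import Level using (0ℓ)
open import Relation.Binary.Bundles using (Setoid)
open import Relation.Binary.PropositionalEquality using (_≡_; refl; sym; trans; _→-setoid_)
import Relation.Binary.Construct.On as On
open import Relation.Nullary.Negation using (¬_)

-- The set [m] = {1, …, m} is represented by Fin m; the element of [m]
-- that i stands for is label i.  All parities refer to labels.
-- Even-sized sets [2n] are written Fin (n * 2), so that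
-- Fin (suc n * 2) is definitionally Fin (suc (suc (n * 2))).

label : ∀ {m} → Fin m → ℕ
label i = suc (toℕ i)

Even Odd : ∀ {m} → Fin m → Set
Even i = 2 ∣ label i
Odd  i = ¬ (2 ∣ label i)

embed : ∀ {n} → Fin (n * 2) → Fin (suc n * 2)
embed j = inject₁ (inject₁ j)

IsDPermutation : ∀ {n} → Permutation′ (n * 2) → Set
IsDPermutation σ = ∀ i →
  (Odd i → label i ≤ label (σ ⟨$⟩ʳ i)) × (Even i → label (σ ⟨$⟩ʳ i) ≤ label i)

DPermutation : ℕ → Set
DPermutation n = Σ (Permutation′ (n * 2)) (IsDPermutation {n})

permutationSetoid : ℕ → Setoid 0ℓ 0ℓ
permutationSetoid m = record
  { Carrier       = Permutation′ m
  ; _≈_           = Perm._≈_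
  ; isEquivalence = record
    { refl  = λ _ → refl
    ; sym   = λ p i → sym (p i)
    ; trans = λ p q i → trans (p i) (q i)
    }
  }

-- D-permutations are compared by their values only.
DPermutationSetoid : ℕ → Setoid 0ℓ 0ℓ
DPermutationSetoid n = On.setoid {B = DPermutation n} (permutationSetoid (n * 2)) proj₁

-- On a finite set, the forward iterates of i under σ exhaust its cycle.
InCycleOf : ∀ {m} → Permutation′ m → Fin m → Fin m → Set
InCycleOf σ i j = ∃ λ k → iterate (σ ⟨$⟩ʳ_) i k ≡ j

IsCycleMaximum : ∀ {m} → Permutation′ m → Fin m → Set
IsCycleMaximum σ j = ∀ i → InCycleOf σ j i → label i ≤ label j

IsFixedPoint : ∀ {m} → (Fin m → Fin m) → Fin m → Set
IsFixedPoint f j = f j ≡ j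

IsIsolatedFixedPoint : ∀ {m} → (Fin m → Fin m) → Fin m → Set
IsIsolatedFixedPoint f j = ∀ i → f i ≡ j ⇔ i ≡ j

IsExcedent : ∀ {m} → (Fin m → Fin m) → Set
IsExcedent f = ∀ i → label i ≤ label (f i)

IsSurjectiveStaircase : ∀ {m} → (Fin (m * 2) → Fin (m * 2)) → Set
IsSurjectiveStaircase f = IsExcedent f × (∀ k → (∃ λ i → f i ≡ k) ⇔ Even k)

IsMaximum : ∀ {m} → (Fin (m * 2) → Fin (m * 2)) → Fin (m * 2) → Set
IsMaximum {m} f j = label j ≤ m * 2 ∸ 2 × label (f j) ≡ m * 2

IsEvenMaximum IsOddMaximum : ∀ {m} → (Fin (m * 2) → Fin (m * 2)) → Fin (m * 2) → Set
IsEvenMaximum {m} f j = Even j × IsMaximum {m} f j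
IsOddMaximum  {m} f j = Odd j × IsMaximum {m} f j

StaircaseWithoutEvenMaxima : ℕ → Set
StaircaseWithoutEvenMaxima m =
  Σ (Fin (m * 2) → Fin (m * 2)) λ f →
    IsSurjectiveStaircase {m} f × (∀ j → ¬ IsEvenMaximum {m} f j)

-- Staircases are compared pointwise.
StaircaseWithoutEvenMaximaSetoid : ℕ → Setoid 0ℓ 0ℓ
StaircaseWithoutEvenMaximaSetoid m =
  On.setoid {B = StaircaseWithoutEvenMaxima m} (Fin (m * 2) →-setoid Fin (m * 2)) proj₁

{-# OPTIONS --safe #-}

-- Write τ = σ⁻¹.  For k ∈ [2n] let φ(σ)(k) be the first of τ k, τ² k, …
-- that is at least k, except that odd fixed points are sent to 2n+2, as are
-- 2n+1 and 2n+2.  Conversely τ k is recovered from f = φ(σ) as follows.  If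
-- f k = 2n+2, then τ k = k.  If k is the least element of its fibre, then
-- τ k = f k.  Otherwise start from the predecessor of k in its fibre and, as
-- long as the current element is even, replace it by the largest element of
-- its own fibre; the odd element reached in this way is τ k.
module Submission where

open import Defs
open import Data.Fin.Base as Fin using (Fin; zero; suc; toℕ; inject₁; fromℕ)
open import Data.Fin.Induction using (Acc; acc; <-wellFounded)
open import Data.Fin.Permutation
  using (Permutation′; _⟨$⟩ʳ_; _⟨$⟩ˡ_; inverseˡ; inverseʳ; permutation)
open import Data.Fin.Properties
  using (_≟_; _<?_; any?; pigeonhole; toℕ-injective; toℕ-inject₁; toℕ-fromℕ; toℕ<n;
         inject₁-injective; fromℕ≢inject₁; ≤∧≢⇒<; ≤-antisym)
open import Data.Fin.Relation.Unary.Top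
  using (view; view-inject₁; view-fromℕ; ‵fromℕ; ‵inj₁; ‵inject₁)
open import Data.Nat.Base using (ℕ; zero; suc; _*_; _≤_; _<_; s≤s; s≤s⁻¹; z≤n)
open import Data.Nat.Divisibility using (_∣_; _∣?_; divides; ∣m+n∣m⇒∣n; ∣1⇒≡1)
open import Data.Nat.GeneralisedArithmetic using (iterate)
import Data.Nat.Properties as ℕ
open import Data.Product.Base using (Σ; ∃; _×_; _,_; proj₁; proj₂)
open import Data.Sum.Base using (_⊎_; inj₁; inj₂)
open import Function.Base using (_∘_)
open import Function.Bundles using (Bijection; _⇔_; mk⇔; Equivalence)
open import Relation.Binary.PropositionalEquality
  using (_≡_; _≢_; _≗_; refl; sym; trans; cong; subst; subst₂)
open import Relation.Nullary using (¬_; Dec; yes; no; contradiction)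
open import Relation.Nullary.Decidable using (_×-dec_)
open import Relation.Unary using (Pred; Decidable)
open import Level using (0ℓ)

private
  variable
    m : ℕ
    b c i j k x y z : Fin m
    τ τ′ : Fin m → Fin m

-- Extremal witnesses of decidable predicates.

least : {P : Pred (Fin m) 0ℓ} → Decidable P → ∃ P →
        ∃ λ k → P k × (∀ j → P j → k Fin.≤ j)
least {suc m} P? (i , p) with P? zero
... | yes p₀ = zero , p₀ , λ _ _ → z≤n
least {suc m} P? (zero , p)  | no ¬p₀ = contradiction p ¬p₀
least {suc m} P? (suc i , p) | no ¬p₀ =
  let k , q , min = least (P? ∘ suc) (i , p) in
  suc k , q , λ { zero p₀ → contradiction p₀ ¬p₀ ; (suc j) r → s≤s (min j r) }

greatest : {P : Pred (Fin m) 0ℓ} → Decidable P → ∃ P →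
           ∃ λ k → P k × (∀ j → P j → j Fin.≤ k)
greatest {suc m} P? (i , p) with any? (P? ∘ suc)
... | yes q =
  let k , r , max = greatest (P? ∘ suc) q in
  suc k , r , λ { zero _ → z≤n ; (suc j) s → s≤s (max j s) }
greatest {suc m} P? (zero , p)  | no ¬q =
  zero , p , λ { zero _ → z≤n ; (suc j) s → contradiction (j , s) ¬q }
greatest {suc m} P? (suc i , p) | no ¬q = contradiction (i , p) ¬q

-- Orbits of injective maps

Inj : (Fin m → Fin m) → Set
Inj τ = ∀ {i j} → τ i ≡ τ j → i ≡ j

iterate-comm : ∀ (τ : Fin m → Fin m) i t → iterate τ (τ i) t ≡ τ (iterate τ i t)
iterate-comm τ i zero    = refl
iterate-comm τ i (suc t) = iterate-comm τ (τ i) t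

-- By pigeonhole two iterates of `k` coincide, and injectivity strips their common initial
-- applications of `τ`.
orbit-returns : Inj τ → ∀ k → ∃ λ t → iterate τ (τ k) t ≡ k
orbit-returns {m} {τ} inj k =
  let i , j , i<j , eq = pigeonhole (ℕ.n<1+n m) (iterate τ k ∘ toℕ) in
  cancel k (toℕ i) (toℕ j) i<j eq
  where
  cancel : ∀ k s t → s < t → iterate τ k s ≡ iterate τ k t →
           ∃ λ t → iterate τ (τ k) t ≡ k
  cancel k zero    (suc t) _         eq = t , sym eq
  cancel k (suc s) (suc t) (s≤s s<t) eq =
    let r , e = cancel (τ k) s t s<t eq in
    r , inj (trans (sym (iterate-comm τ (τ k) r)) e)

iterate-closed : {P : Pred (Fin m) 0ℓ} → (∀ {i} → P i → P (τ i)) →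
                 ∀ t → P i → P (iterate τ i t)
iterate-closed closed zero    p = p
iterate-closed {P = P} closed (suc t) p = iterate-closed {P = P} closed t (closed p)

-- The orbit of `τ i` comes back to `i`, so a backward step is a number of forward ones.
inverse-closed : {P : Pred (Fin m) 0ℓ} → Inj τ → (∀ {i} → P i → P (τ i)) →
                 ∀ {i} → P (τ i) → P i
inverse-closed {τ = τ} {P = P} inj closed {i} p =
  let t , eq = orbit-returns inj i in
  subst P eq (iterate-closed {i = τ i} {P = P} closed t p)

-- First orbit elements above a threshold.

-- The start `k` is never tested against `b`. Threshold and start are separate because the recursion
-- moves only the start.
data FirstAbove (τ : Fin m → Fin m) (b k x : Fin m) : Set where
  here  : b Fin.≤ x → τ k ≡ x → FirstAbove τ b k x
  there : τ k Fin.< b → FirstAbove τ b (τ k) x → FirstAbove τ b k x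

bound : FirstAbove τ b k x → b Fin.≤ x
bound (here b≤x _) = b≤x
bound (there _ r)  = bound r

deterministic : FirstAbove τ b k x → FirstAbove τ b k y → x ≡ y
deterministic (here _ p)      (here _ q)       = trans (sym p) q
deterministic (here b≤x refl) (there lt _)     = contradiction lt (ℕ.≤⇒≯ b≤x)
deterministic (there lt _)    (here b≤x refl)  = contradiction lt (ℕ.≤⇒≯ b≤x)
deterministic (there _ r)     (there _ s)      = deterministic r s

raise : b Fin.≤ c → c Fin.≤ x → FirstAbove τ b k x → FirstAbove τ c k x
raise b≤c c≤x (here _ eq)  = here c≤x eq
raise b≤c c≤x (there lt r) = there (ℕ.<-≤-trans lt b≤c) (raise b≤c c≤x r)

glue : b Fin.≤ c → y Fin.< c →
       FirstAbove τ b k y → FirstAbove τ c y z → FirstAbove τ c k z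
glue b≤c y<c (here _ refl) r = there y<c r
glue b≤c y<c (there lt s)  r = there (ℕ.<-≤-trans lt b≤c) (glue b≤c y<c s r)

-- After the first step `τ` is applied only to skipped elements, all of them below `b`.
transport : (∀ j → j Fin.< b → τ j ≡ τ′ j) → τ k ≡ τ′ k →
            FirstAbove τ b k x → FirstAbove τ′ b k x
transport agree eq (here b≤x p) = here b≤x (trans (sym eq) p)
transport {τ = τ} {τ′ = τ′} {x = x} agree eq (there lt r) =
  there (subst (Fin._< _) eq lt)
        (subst (λ y → FirstAbove τ′ _ y x) eq (transport agree (agree _ lt) r))

-- The number `t` is fuel: it counts the steps to an orbit element known to reach the threshold.
search : ∀ t → b Fin.≤ iterate τ (τ k) t → ∃ (FirstAbove τ b k)
search {b = b} {τ = τ} {k = k} t le with τ k <? b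
search t       le | no  ge = _ , here (ℕ.≮⇒≥ ge) refl
search zero    le | yes lt = contradiction lt (ℕ.≤⇒≯ le)
search (suc t) le | yes lt = let x , r = search t le in x , there lt r

firstAbove : Inj τ → ∀ k → ∃ (FirstAbove τ k k)
firstAbove inj k =
  let t , eq = orbit-returns inj k in
  search t (ℕ.≤-reflexive (cong toℕ (sym eq)))

lastStep : FirstAbove τ b k x → ∃ λ s → τ s ≡ x × (s ≡ k ⊎ s Fin.< b)
lastStep (here _ eq)  = _ , eq , inj₁ refl
lastStep (there lt r) with lastStep r
... | s , eq , inj₁ refl = s , eq , inj₂ lt
... | s , eq , inj₂ s<b  = s , eq , inj₂ s<b

reachesFixed : Inj τ → FirstAbove τ b k x → τ x ≡ x → k ≡ x
reachesFixed inj (here _ eq)  fix = inj (trans eq (sym fix))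
reachesFixed inj (there lt r) fix = inj (trans (reachesFixed inj r fix) (sym fix))

-- A `τ`-walk from `b` that leaves only elements below `c`. It grows at its far end, so that its
-- last steps can be peeled off.
data Path (τ : Fin m → Fin m) (c b : Fin m) : Fin m → Set where
  []   : Path τ c b b
  snoc : Path τ c b y → y Fin.< c → τ y ≡ z → Path τ c b z

pathToLast : Inj τ → FirstAbove τ c y x → y Fin.< c → Path τ c b y →
             ∀ {s} → τ s ≡ x → Path τ c b s
pathToLast inj (here _ eq)  y<c p eq′ = subst (Path _ _ _) (inj (trans eq (sym eq′))) p
pathToLast inj (there lt r) y<c p eq′ = pathToLast inj r lt (snoc p y<c refl) eq′

-- With σ = τ⁻¹, both i and j are the σ-ends of their paths below c, and these paths have
-- the same τ-end; so they are the same path.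
sameEnd : Inj τ → FirstAbove τ c i x → FirstAbove τ c j x → i Fin.< c → j Fin.< c →
          (∀ z → z Fin.< c → τ z ≢ i) → (∀ z → z Fin.< c → τ z ≢ j) → i ≡ j
sameEnd {τ = τ} {c = c} {j = j} inj r s i<c j<c ¬i ¬j
  with extend r i<c (pathToLast inj s j<c [])
  where
  extend : FirstAbove τ c i x → i Fin.< c → (∀ {s} → τ s ≡ x → Path τ c j s) →
           Path τ c j i
  extend (here _ eq) i<c p = p eq
  extend (there lt r) i<c p with extend r lt p
  ... | []                 = contradiction refl (¬j _ i<c)
  ... | snoc q z<c τz≡τi   = subst (Path τ c j) (inj τz≡τi) q
... | []            = refl
... | snoc q z<c eq = contradiction eq (¬i _ z<c)

-- Appending the two points 2n+1 and 2n+2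

inject₂ : Fin m → Fin (suc (suc m))
inject₂ i = inject₁ (inject₁ i)

pretop top : Fin (suc (suc m))
pretop = inject₁ (fromℕ _)
top    = fromℕ _

inject₂-injective : inject₂ i ≡ inject₂ j → i ≡ j
inject₂-injective eq = inject₁-injective (inject₁-injective eq)

inject₂≢top : inject₂ i ≢ top
inject₂≢top eq = fromℕ≢inject₁ (sym eq)

inject₂≢pretop : inject₂ i ≢ pretop
inject₂≢pretop eq = fromℕ≢inject₁ (sym (inject₁-injective eq))

toℕ-inject₂ : ∀ (i : Fin m) → toℕ (inject₂ i) ≡ toℕ i
toℕ-inject₂ i = trans (toℕ-inject₁ (inject₁ i)) (toℕ-inject₁ i)

label-top : label (top {m}) ≡ suc (suc m)
label-top = cong suc (toℕ-fromℕ _)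

label-pretop : label (pretop {m}) ≡ suc m
label-pretop = cong suc (trans (toℕ-inject₁ _) (toℕ-fromℕ _))

data Cover : Fin (suc (suc m)) → Set where
  old   : ∀ (i : Fin m) → Cover (inject₂ i)
  isPre : Cover (pretop {m})
  isTop : Cover (top {m})

cover : ∀ (i : Fin (suc (suc m))) → Cover i
cover i with view i
... | ‵fromℕ              = isTop
... | ‵inj₁ ‵fromℕ        = isPre
... | ‵inj₁ (‵inject₁ j)  = old j

extend : (Fin m → Fin (suc (suc m))) → Fin (suc (suc m)) → Fin (suc (suc m))
extend g i with view i
... | ‵fromℕ             = top
... | ‵inj₁ ‵fromℕ       = top
... | ‵inj₁ (‵inject₁ j) = g j

extend-inject₂ : ∀ (g : Fin m → Fin (suc (suc m))) i → extend g (inject₂ i) ≡ g i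
extend-inject₂ g i rewrite view-inject₁ (inject₁ i) | view-inject₁ i = refl

extend-pretop : ∀ (g : Fin m → Fin (suc (suc m))) → extend g pretop ≡ top
extend-pretop {m} g rewrite view-inject₁ (fromℕ m) | view-fromℕ m = refl

extend-top : ∀ (g : Fin m → Fin (suc (suc m))) → extend g top ≡ top
extend-top {m} g rewrite view-fromℕ (suc m) = refl

even? : ∀ (i : Fin m) → Dec (Even i)
even? i = 2 ∣? label i

inject₂-even : Even i → Even (inject₂ i)
inject₂-even {i = i} = subst (λ l → 2 ∣ suc l) (sym (toℕ-inject₂ i))

even-inject₂ : Even (inject₂ i) → Even i
even-inject₂ {i = i} = subst (λ l → 2 ∣ suc l) (toℕ-inject₂ i)

-- The code of a D-permutation

-- As a relation, this lets an encoded permutation and a given staircase be compared by uniqueness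
-- alone, without computing either.
data Code (τ : Fin m → Fin m) (k : Fin m) (v : Fin (suc (suc m))) : Set where
  special  : v ≡ top → τ k ≡ k → Odd k → Code τ k v
  ordinary : ∀ x → v ≡ inject₂ x → FirstAbove τ k k x → Even x → Code τ k v

code-unique : τ ≗ τ′ → ∀ {v w} → Code τ k v → Code τ′ k w → v ≡ w
code-unique eq (special p _ _) (special q _ _) = trans p (sym q)
-- A fixed point is its own first return, so `k` would be both odd and even.
code-unique eq (special _ fix odd) (ordinary x _ r even) =
  contradiction (subst Even (deterministic r (here ℕ.≤-refl (trans (sym (eq _)) fix))) even) odd
code-unique eq (ordinary x _ r even) (special _ fix odd) =
  contradiction (subst Even (deterministic r (here ℕ.≤-refl (trans (eq _) fix))) even) odd
code-unique eq (ordinary x p r _) (ordinary y q s _) =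
  trans p (trans (cong inject₂ (deterministic (transport (λ j _ → eq j) (eq _) r) s)) (sym q))

-- Otherwise `x` has a `τ′`-preimage below `k`. The maps agree there, so `x` has a second
-- `τ`-preimage besides `k`.
¬crossing : Inj τ → (∀ j → j Fin.< k → τ j ≡ τ′ j) →
            τ k ≡ x → τ′ k Fin.< k → ¬ FirstAbove τ′ k (τ′ k) x
¬crossing inj agree eq lt r with lastStep r
... | s , eq′ , inj₁ refl = ℕ.<⇒≢ lt (cong toℕ (inj (trans (agree s lt) (trans eq′ (sym eq)))))
... | s , eq′ , inj₂ s<k  = ℕ.<⇒≢ s<k (cong toℕ (inj (trans (agree s s<k) (trans eq′ (sym eq)))))

-- The main case has both images of `k` below `k`. Neither has a `τ`-preimage below `k`, and both
-- lead to `x`, so `sameEnd` identifies them.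
sameStep : Inj τ → Inj τ′ → (∀ j → j Fin.< k → τ j ≡ τ′ j) →
           FirstAbove τ k k x → FirstAbove τ′ k k x → τ k ≡ τ′ k
sameStep inj inj′ agree (here _ p)   (here _ q)   = trans p (sym q)
sameStep inj inj′ agree (here _ p)   (there lt s) = contradiction s (¬crossing inj agree p lt)
sameStep inj inj′ agree (there lt r) (here _ q)   =
  contradiction r (¬crossing inj′ (λ j j<k → sym (agree j j<k)) q lt)
sameStep inj inj′ agree (there lt r) (there lt′ s) =
  sameEnd inj r (transport agree′ (agree′ _ lt′) s) lt lt′
    (λ z z<k eq → ℕ.<⇒≢ z<k (cong toℕ (inj eq)))
    (λ z z<k eq → ℕ.<⇒≢ z<k (cong toℕ (inj′ (trans (agree′ z z<k) eq))))
  where agree′ = λ j (j<k : j Fin.< _) → sym (agree j j<k)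

-- Strong induction on `k`: the values of `τ` below `k` together with the code at `k` determine
-- `τ k`.
code-injective : {τ τ′ : Fin m → Fin m} {f : Fin m → Fin (suc (suc m))} → Inj τ → Inj τ′ →
                 (∀ k → Code τ k (f k)) → (∀ k → Code τ′ k (f k)) →
                 τ ≗ τ′
code-injective {τ = τ} {τ′ = τ′} inj inj′ C C′ k = go k (<-wellFounded k)
  where
  go : ∀ k → Acc Fin._<_ k → τ k ≡ τ′ k
  go k _        with C k | C′ k
  go k _        | special _ p _    | special _ q _    = trans p (sym q)
  go k _        | special p _ _    | ordinary _ q _ _ = contradiction (trans (sym q) p) inject₂≢top
  go k _        | ordinary _ q _ _ | special p _ _    = contradiction (trans (sym q) p) inject₂≢top
  go k (acc rs) | ordinary x p r _ | ordinary y q s _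
    with refl ← inject₂-injective (trans (sym p) q) =
    sameStep inj inj′ (λ j j<k → go j (rs j<k)) r s

-- Decoding

Next : (Fin m → Fin (suc (suc m))) → Fin m → Fin m → Set
Next F i k = i Fin.< k × F i ≡ F k × (∀ j → F j ≡ F i → i Fin.< j → k Fin.≤ j)

First Last : (Fin m → Fin (suc (suc m))) → Fin m → Set
First F k = ∀ j → F j ≡ F k → k Fin.≤ j
Last  F k = ∀ j → F j ≡ F k → j Fin.≤ k

-- The decoding walk read backwards: the largest element of a fibre passes to the value of that
-- fibre, any other element to its successor. In this direction the walk is deterministic.
data Climb (F : Fin m → Fin (suc (suc m))) (i k : Fin m) : Set where
  next : ∀ {x} → F i ≡ inject₂ x → Next F i k → Climb F i k
  up   : ∀ {x} → F i ≡ inject₂ x → Last F i → Climb F x k → Climb F i k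

-- Step F i k says that the decoded permutation maps i to k.
data Step (F : Fin m → Fin (suc (suc m))) (i k : Fin m) : Set where
  loop  : F i ≡ top → i ≡ k → Step F i k
  drop  : Even i → F k ≡ inject₂ i → First F k → Step F i k
  climb : Odd i → Climb F i k → Step F i k

module _ {F : Fin m → Fin (suc (suc m))} where

  next-functional : Next F i j → Next F i k → j ≡ k
  next-functional (i<j , eq , min) (i<k , eq′ , min′) =
    ≤-antisym (min _ (sym eq′) i<k) (min′ _ (sym eq) i<j)

  next-not-last : Next F i j → ¬ Last F i
  next-not-last (i<j , eq , _) last = ℕ.<⇒≱ i<j (last _ (sym eq))

  climb-functional : Climb F i j → Climb F i k → j ≡ k
  climb-functional (next _ n)   (next _ n′)   = next-functional n n′
  climb-functional (next _ n)   (up _ l _)    = contradiction l (next-not-last n)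
  climb-functional (up _ l _)   (next _ n)    = contradiction l (next-not-last n)
  climb-functional (up eq _ c) (up eq′ _ c′)
    with refl ← inject₂-injective (trans (sym eq) eq′) = climb-functional c c′

  climb-source : Climb F i k → F i ≢ top
  climb-source (next eq _) eq′ = inject₂≢top (trans (sym eq) eq′)
  climb-source (up eq _ _) eq′ = inject₂≢top (trans (sym eq) eq′)

  climb-target : Climb F i k → F k ≢ top
  climb-target (next eq (_ , eq′ , _)) eq″ = inject₂≢top (trans (sym eq) (trans eq′ eq″))
  climb-target (up _ _ c) = climb-target c

  -- The value and the parity of `i` decide which constructor applies.
  step-functional : (∀ {i} → F i ≡ top → Odd i) → Step F i j → Step F i k → j ≡ k
  step-functional odd (loop _ p)     (loop _ q)     = trans (sym p) q
  step-functional odd (loop p _)     (drop e _ _)   = contradiction e (odd p)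
  step-functional odd (loop p _)     (climb _ c)    = contradiction p (climb-source c)
  step-functional odd (drop e _ _)   (loop p _)     = contradiction e (odd p)
  step-functional odd (drop _ p f)   (drop _ q g)   =
    ≤-antisym (f _ (trans q (sym p))) (g _ (trans p (sym q)))
  step-functional odd (drop e _ _)   (climb o _)    = contradiction e o
  step-functional odd (climb _ c)    (loop p _)     = contradiction p (climb-source c)
  step-functional odd (climb o _)    (drop e _ _)   = contradiction e o
  step-functional odd (climb _ c)    (climb _ d)    = climb-functional c d

  module _ (exc : ∀ {i x} → F i ≡ inject₂ x → i Fin.≤ x) where

    climb-< : Climb F i k → i Fin.< k
    climb-< (next _ (i<k , _)) = i<k
    climb-< (up eq _ c)        = ℕ.≤-<-trans (exc eq) (climb-< c)

    -- At `next`, both elements have value `x`, which is at least `k`, so the threshold rises from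
    -- `i` to `k`. At `up`, the walk from `i` to its value is glued to the rest of the climb.
    climb-firstAbove : Climb F i k →
                       (∀ j → j Fin.< k → ∀ {y} → F j ≡ inject₂ y → FirstAbove τ j j y) →
                       F k ≡ inject₂ x → FirstAbove τ k i x
    climb-firstAbove (next _ (i<k , eq , _)) ih p =
      raise (ℕ.<⇒≤ i<k) (exc p) (ih _ i<k (trans eq p))
    climb-firstAbove (up eq _ c) ih p =
      glue (ℕ.<⇒≤ (ℕ.≤-<-trans (exc eq) (climb-< c))) (climb-< c)
           (ih _ (ℕ.≤-<-trans (exc eq) (climb-< c)) eq) (climb-firstAbove c ih p)

    -- Strong induction on `k`: a drop reaches the value at once, while a climb starts below `k` and
    -- is assembled from walks of smaller elements.
    step-firstAbove : (∀ k → Step F (τ k) k) → ∀ k → Acc Fin._<_ k → ∀ {x} →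
                      F k ≡ inject₂ x → FirstAbove τ k k x
    step-firstAbove {τ = τ} S k (acc rs) p with S k
    ... | loop q eq   =
      contradiction (trans (sym p) (trans (cong F (sym eq)) q)) inject₂≢top
    ... | drop _ q _  = here (exc p) (inject₂-injective (trans (sym q) p))
    ... | climb _ c   =
      there (climb-< c) (climb-firstAbove c (λ j j<k → step-firstAbove S j (rs j<k)) p)

    module _ (val : ∀ i → (F i ≡ top × Odd i) ⊎ ∃ λ x → F i ≡ inject₂ x × Even x)
             (sur : ∀ x → Even x → ∃ λ i → F i ≡ inject₂ x) where

      special⇒odd : F i ≡ top → Odd i
      special⇒odd {i = i} eq with val i
      ... | inj₁ (_ , odd)   = odd
      ... | inj₂ (y , q , e) = contradiction (trans (sym q) eq) inject₂≢top

      -- Since `i` lies below its value it is not fixed by `F`. The largest element of the fibre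
      -- over an even `i` is therefore smaller than `i`, and it again lies below its own value.
      descend : ∀ i → Acc Fin._<_ i → F i ≡ inject₂ x → i Fin.< x → Climb F i k →
                ∃ λ j → Odd j × Climb F j k
      descend i (acc rs) eq i<x c with even? i
      ... | no odd = i , odd , c
      ... | yes e  =
        let j , q , last = greatest (λ j → F j ≟ inject₂ i) (sur i e)
            j<i = ≤∧≢⇒< (exc q) λ j≡i →
                    ℕ.<⇒≢ i<x (cong toℕ (inject₂-injective
                      (trans (sym q) (trans (cong F j≡i) eq))))
        in descend j (rs j<i) q j<i (up q (λ l p → last l (trans p q)) c)

      step-total : ∀ k → ∃ λ i → Step F i k
      step-total k with val k
      ... | inj₁ (q , _)     = k , loop q refl
      ... | inj₂ (x , q , e) with any? (λ j → (F j ≟ F k) ×-dec (j <? k))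
      ...   | no none = x , drop e q λ j eq → ℕ.≮⇒≥ λ j<k → none (j , eq , j<k)
      ...   | yes some =
        let i , (eq , i<k) , max = greatest (λ j → (F j ≟ F k) ×-dec (j <? k)) some
            n = i<k , eq , λ j eq′ i<j → ℕ.≮⇒≥ λ j<k →
                  ℕ.<⇒≱ i<j (max j (trans eq′ eq , j<k))
            -- `k` is at most the common value `x`, so its predecessor `i` is strictly below `x`.
            j , odd , c = descend i (<-wellFounded i) (trans eq q)
                            (ℕ.<-≤-trans i<k (exc q)) (next (trans eq q) n)
        in j , climb odd c

      decode : Fin m → Fin m
      decode k = proj₁ (step-total k)

      decode-step : ∀ k → Step F (decode k) k
      decode-step k = proj₂ (step-total k)

      -- A source has only one target under `Step`.
      decode-injective : Inj decode
      decode-injective {i} {j} eq =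
        step-functional special⇒odd (decode-step i)
          (subst (λ l → Step F l j) (sym eq) (decode-step j))

      decode-code : ∀ k → Code decode k (F k)
      decode-code k with val k
      ... | inj₂ (x , q , e) = ordinary x q (step-firstAbove decode-step k (<-wellFounded k) q) e
      ... | inj₁ (q , odd) with decode-step k
      ...   | loop _ eq  = special q eq odd
      ...   | drop _ p _ = contradiction (trans (sym p) q) inject₂≢top
      ...   | climb _ c  = contradiction q (climb-target c)

      -- The orbit element just before a return to `k` is its preimage.
      decodeInverse : Fin m → Fin m
      decodeInverse k = iterate decode k (proj₁ (orbit-returns decode-injective k))

      decode-inverse : ∀ k → decode (decodeInverse k) ≡ k
      decode-inverse k =
        trans (sym (iterate-comm decode k (proj₁ (orbit-returns decode-injective k))))
              (proj₂ (orbit-returns decode-injective k))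

      -- Decoding recovers `σ⁻¹`, so `decode` is the backward map.
      decoded : Permutation′ m
      decoded = permutation decodeInverse decode
        (λ k → decode-injective (decode-inverse (decode k))) decode-inverse

      -- The step from `i` to its image decides: a loop stays, a drop leads from an even `i` to an
      -- element not above it, a climb raises an odd `i`.
      decoded-D : ∀ i → (Odd i → label i ≤ label (decoded ⟨$⟩ʳ i)) ×
                        (Even i → label (decoded ⟨$⟩ʳ i) ≤ label i)
      decoded-D i with decoded ⟨$⟩ʳ i | subst (λ l → Step F l (decodeInverse i)) (decode-inverse i)
                                           (decode-step (decodeInverse i))
      ... | k | loop _ refl = (λ _ → ℕ.≤-refl) , (λ _ → ℕ.≤-refl)
      ... | k | drop e p _  = contradiction e , λ _ → s≤s (exc p)
      ... | k | climb o c   = (λ _ → s≤s (ℕ.<⇒≤ (climb-< c))) , λ e → contradiction e o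

-- Encoding

back-injective : ∀ (σ : Permutation′ m) → Inj (σ ⟨$⟩ˡ_)
back-injective σ eq = trans (sym (inverseʳ σ)) (trans (cong (σ ⟨$⟩ʳ_) eq) (inverseʳ σ))

forth-injective : ∀ (σ : Permutation′ m) → Inj (σ ⟨$⟩ʳ_)
forth-injective σ eq = trans (sym (inverseˡ σ)) (trans (cong (σ ⟨$⟩ˡ_) eq) (inverseˡ σ))

back-fixed : ∀ (σ : Permutation′ m) → σ ⟨$⟩ʳ i ≡ i → σ ⟨$⟩ˡ i ≡ i
back-fixed σ eq = trans (cong (σ ⟨$⟩ˡ_) (sym eq)) (inverseˡ σ)

forth-fixed : ∀ (σ : Permutation′ m) → σ ⟨$⟩ˡ i ≡ i → σ ⟨$⟩ʳ i ≡ i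
forth-fixed σ eq = trans (cong (σ ⟨$⟩ʳ_) (sym eq)) (inverseʳ σ)

back-cong : ∀ (σ ρ : Permutation′ m) → (σ ⟨$⟩ʳ_) ≗ (ρ ⟨$⟩ʳ_) → (σ ⟨$⟩ˡ_) ≗ (ρ ⟨$⟩ˡ_)
back-cong σ ρ eq k =
  trans (sym (inverseˡ ρ)) (cong (ρ ⟨$⟩ˡ_) (trans (sym (eq _)) (inverseʳ σ)))

forth-cong : ∀ (σ ρ : Permutation′ m) → (σ ⟨$⟩ˡ_) ≗ (ρ ⟨$⟩ˡ_) → (σ ⟨$⟩ʳ_) ≗ (ρ ⟨$⟩ʳ_)
forth-cong σ ρ eq k =
  trans (sym (inverseʳ ρ)) (cong (ρ ⟨$⟩ʳ_) (trans (sym (eq _)) (inverseˡ σ)))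

inCycle-forth : ∀ (σ : Permutation′ m) → InCycleOf σ j i → InCycleOf σ j (σ ⟨$⟩ʳ i)
inCycle-forth {j = j} σ (t , eq) =
  suc t , trans (iterate-comm (σ ⟨$⟩ʳ_) j t) (cong (σ ⟨$⟩ʳ_) eq)

inCycle-back : ∀ (σ : Permutation′ m) → InCycleOf σ j i → InCycleOf σ j (σ ⟨$⟩ˡ i)
inCycle-back {j = j} σ c =
  inverse-closed {P = InCycleOf σ j} (forth-injective σ) (inCycle-forth σ)
    (subst (InCycleOf σ j) (sym (inverseʳ σ)) c)

inCycle-firstAbove : ∀ (σ : Permutation′ m) → FirstAbove (σ ⟨$⟩ˡ_) b k x →
                     InCycleOf σ j k → InCycleOf σ j x
inCycle-firstAbove {j = j} σ (here _ eq) p = subst (InCycleOf σ j) eq (inCycle-back σ p)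
inCycle-firstAbove σ (there _ r) p = inCycle-firstAbove σ r (inCycle-back σ p)

cycleMaximum⇔ : ∀ (σ : Permutation′ m) → IsCycleMaximum σ j ⇔ FirstAbove (σ ⟨$⟩ˡ_) j j j
cycleMaximum⇔ {j = j} σ = mk⇔ to from
  where
  to : IsCycleMaximum σ j → FirstAbove (σ ⟨$⟩ˡ_) j j j
  to max with firstAbove (back-injective σ) j
  ... | x , r = subst (FirstAbove _ j j)
    (≤-antisym (s≤s⁻¹ (max x (inCycle-firstAbove σ r (0 , refl)))) (bound r)) r
  -- An invariant of the whole cycle of `j`: closed under the inverse map, hence also under `σ`.
  P : Fin _ → Set
  P y = FirstAbove (σ ⟨$⟩ˡ_) j y j × y Fin.≤ j
  from : FirstAbove (σ ⟨$⟩ˡ_) j j j → IsCycleMaximum σ j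
  from r i (t , eq) = s≤s (proj₂ (subst P eq (iterate-closed {P = P} forth t (r , ℕ.≤-refl))))
    where
    back : ∀ {y} → P y → P (σ ⟨$⟩ˡ y)
    back (here _ refl , _) = r , ℕ.≤-refl
    back (there lt s , _)  = s , ℕ.<⇒≤ lt
    forth : ∀ {y} → P y → P (σ ⟨$⟩ʳ y)
    forth {y} p = inverse-closed {P = P} (back-injective σ) back (subst P (sym (inverseˡ σ)) p)

-- Parities and labels around the added points.

top-even : ∀ n → 2 ∣ label (top {n * 2})
top-even n = divides (suc n) label-top

pretop-odd : ∀ n → Odd (pretop {n * 2})
pretop-odd n p
  with ∣1⇒≡1 (∣m+n∣m⇒∣n (subst (2 ∣_) (trans label-pretop (ℕ.+-comm 1 (n * 2))) p) (divides n refl))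
... | ()

label-top⁻¹ : ∀ {i : Fin (suc (suc m))} → label i ≡ suc (suc m) → i ≡ top
label-top⁻¹ eq = toℕ-injective (ℕ.suc-injective (trans eq (sym label-top)))

label-inject₂-≤ : ∀ (i : Fin m) → label (inject₂ i) ≤ m
label-inject₂-≤ {m} i = subst (λ l → suc l ≤ m) (sym (toℕ-inject₂ i)) (toℕ<n i)

-- The staircase of a D-permutation.

module _ (n : ℕ) (D : DPermutation n) where

  private
    σ = proj₁ D
    back = σ ⟨$⟩ˡ_

  odd-back : Odd (back k) → back k Fin.≤ k
  odd-back {k} o =
    s≤s⁻¹ (subst (λ l → label (back k) ≤ label l) (inverseʳ σ) (proj₁ (proj₂ D (back k)) o))

  even-forth : Even x → σ ⟨$⟩ʳ x Fin.≤ x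
  even-forth e = s≤s⁻¹ (proj₂ (proj₂ D _) e)

  -- Let `x` be the image of `s` under `back`, with `s` at most `k` and `k` at most `x`. An odd `x`
  -- is also at most `s`, so it is a fixed point, which is reached only from itself; then `k` is an
  -- odd fixed point.
  firstAbove-even : ¬ (back k ≡ k × Odd k) → FirstAbove back k k x → Even x
  firstAbove-even {k} {x} ¬fix r with even? x
  ... | yes e = e
  ... | no  o with lastStep r
  ...   | s , refl , s≤k =
    contradiction (trans (cong back k≡x) (trans fixed (sym k≡x)) , subst Odd (sym k≡x) o)
                  ¬fix
    where
    below : s ≡ k ⊎ s Fin.< k → s Fin.≤ k
    below (inj₁ refl) = ℕ.≤-refl
    below (inj₂ lt)   = ℕ.<⇒≤ lt
    s≡x : s ≡ back s
    s≡x = ≤-antisym (ℕ.≤-trans (below s≤k) (bound r)) (odd-back o)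
    fixed : back (back s) ≡ back s
    fixed = cong back (sym s≡x)
    k≡x : k ≡ back s
    k≡x = reachesFixed (back-injective σ) r fixed

  value : ∀ k → ∃ (Code back k)
  value k with even? k | back k ≟ k
  ... | no o | yes fix = top , special refl fix o
  ... | yes e | _ =
    let x , r = firstAbove (back-injective σ) k in
    inject₂ x , ordinary x refl r (firstAbove-even (λ p → proj₂ p e) r)
  ... | no _ | no ¬fix =
    let x , r = firstAbove (back-injective σ) k in
    inject₂ x , ordinary x refl r (firstAbove-even (λ p → ¬fix (proj₁ p)) r)

  encode : Fin (suc n * 2) → Fin (suc n * 2)
  encode = extend (proj₁ ∘ value)

  encode-code : ∀ k → Code back k (encode (inject₂ k))
  encode-code k = subst (Code back k) (sym (extend-inject₂ (proj₁ ∘ value) k)) (proj₂ (value k))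

  encode-firstAbove : FirstAbove back k k x → Even x → encode (inject₂ k) ≡ inject₂ x
  encode-firstAbove r e = code-unique (λ _ → refl) (encode-code _) (ordinary _ refl r e)

  firstAbove-encode : encode (inject₂ k) ≡ inject₂ x → FirstAbove back k k x × Even x
  firstAbove-encode {k} eq with encode-code k
  ... | special p _ _ = contradiction (trans (sym eq) p) inject₂≢top
  ... | ordinary y p r e with refl ← inject₂-injective (trans (sym p) eq) = r , e

  -- One backward step from `σ x` gives `x`, which is not smaller. Hence every even old point is a
  -- value.
  encode-forth : Even x → encode (inject₂ (σ ⟨$⟩ʳ x)) ≡ inject₂ x
  encode-forth e = encode-firstAbove (here (even-forth e) (inverseˡ σ)) e

  encode-special : encode (inject₂ k) ≡ top → back k ≡ k × Odd k
  encode-special {k} eq with encode-code k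
  ... | special _ fix odd = fix , odd
  ... | ordinary y p r e  = contradiction (trans (sym p) eq) inject₂≢top

  special-encode : back k ≡ k → Odd k → encode (inject₂ k) ≡ top
  special-encode fix odd = code-unique (λ _ → refl) (encode-code _) (special refl fix odd)

  encode-ordinary : encode i ≡ inject₂ x → ∃ λ k → i ≡ inject₂ k × FirstAbove back k k x × Even x
  encode-ordinary {i} eq with cover i
  ... | old k = k , refl , firstAbove-encode eq
  ... | isPre = contradiction (trans (sym eq) (extend-pretop (proj₁ ∘ value))) inject₂≢top
  ... | isTop = contradiction (trans (sym eq) (extend-top (proj₁ ∘ value))) inject₂≢top

  encode-excedent : IsExcedent encode
  encode-excedent i with cover i
  ... | isPre = subst (λ j → label (pretop {n * 2}) ≤ label j) (sym (extend-pretop (proj₁ ∘ value)))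
                  (ℕ.≤-trans (ℕ.≤-reflexive label-pretop)
                    (ℕ.≤-trans (ℕ.n≤1+n _) (ℕ.≤-reflexive (sym label-top))))
  ... | isTop = ℕ.≤-reflexive (cong label (sym (extend-top (proj₁ ∘ value))))
  ... | old k with encode-code k
  ...   | special p _ _ = subst (λ j → label (inject₂ k) ≤ label j) (sym p)
                  (ℕ.≤-trans (label-inject₂-≤ k)
                    (ℕ.≤-trans (ℕ.m≤n+m _ 2) (ℕ.≤-reflexive (sym label-top))))
  ...   | ordinary x p r _ = subst (λ j → label (inject₂ k) ≤ label j) (sym p)
                  (s≤s (subst₂ _≤_ (sym (toℕ-inject₂ k)) (sym (toℕ-inject₂ x)) (bound r)))

  encode-image : ∀ k → (∃ λ i → encode i ≡ k) ⇔ Even k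
  encode-image k with cover k
  ... | isTop = mk⇔ (λ _ → top-even n) (λ _ → top , extend-top (proj₁ ∘ value))
  ... | old x = mk⇔ (λ (i , eq) → inject₂-even (proj₂ (proj₂ (proj₂ (encode-ordinary {i} eq)))))
                    (λ e → inject₂ (σ ⟨$⟩ʳ x) , encode-forth (even-inject₂ e))
  ... | isPre = mk⇔ (λ (i , eq) → contradiction eq (missed i)) (λ e → contradiction e (pretop-odd n))
    where
    missed : ∀ i → encode i ≢ pretop
    missed i eq with cover i
    ... | isPre = fromℕ≢inject₁ (trans (sym (extend-pretop (proj₁ ∘ value))) eq)
    ... | isTop = fromℕ≢inject₁ (trans (sym (extend-top (proj₁ ∘ value))) eq)
    ... | old j with encode-code j
    ...   | special p _ _ = fromℕ≢inject₁ (trans (sym p) eq)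
    ...   | ordinary x p _ _ = inject₂≢pretop (trans (sym p) eq)

  -- The label bound in the notion of maximum excludes both added points, leaving the odd fixed
  -- points.
  encode-maximum : IsMaximum {suc n} encode i → ∃ λ k → i ≡ inject₂ k × back k ≡ k × Odd k
  encode-maximum {i} (le , eq) with cover i
  ... | old k = k , refl , encode-special (label-top⁻¹ eq)
  ... | isPre = contradiction (ℕ.≤-trans (ℕ.≤-reflexive (sym label-pretop)) le) (ℕ.<-irrefl refl)
  ... | isTop = contradiction
    (ℕ.≤-trans (ℕ.n≤1+n _) (ℕ.≤-trans (ℕ.≤-reflexive (sym label-top)) le)) (ℕ.<-irrefl refl)

  encode-no-even-maximum : ∀ i → ¬ IsEvenMaximum {suc n} encode i
  encode-no-even-maximum i (e , max) with encode-maximum max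
  ... | k , refl , _ , odd = odd (even-inject₂ e)

  staircase : StaircaseWithoutEvenMaxima (suc n)
  staircase = encode , (encode-excedent , encode-image) , encode-no-even-maximum

  -- The three correspondences.

  cycleMaximum⇔fixedPoint :
    (Even j × IsCycleMaximum σ j) ⇔ IsFixedPoint encode (inject₂ j)
  cycleMaximum⇔fixedPoint = mk⇔
    (λ (e , max) → encode-firstAbove (Equivalence.to (cycleMaximum⇔ σ) max) e)
    (λ eq → let r , e = firstAbove-encode eq in e , Equivalence.from (cycleMaximum⇔ σ) r)

  -- A fixed point of `σ` is reached only from itself. Conversely, `encode` sends `σ j` to `j` for
  -- even `j`, so isolation forces `σ j` to be `j`.
  fixedPoint⇔isolated :
    (Even j × IsFixedPoint (σ ⟨$⟩ʳ_) j) ⇔ IsIsolatedFixedPoint encode (inject₂ j)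
  fixedPoint⇔isolated {j} = mk⇔ to from
    where
    to : Even j × IsFixedPoint (σ ⟨$⟩ʳ_) j → IsIsolatedFixedPoint encode (inject₂ j)
    to (e , fix) i = mk⇔ alone λ { refl → encode-firstAbove (here ℕ.≤-refl (back-fixed σ fix)) e }
      where
      alone : encode i ≡ inject₂ j → i ≡ inject₂ j
      alone eq with encode-ordinary {i} eq
      ... | k , refl , r , _ = cong inject₂ (reachesFixed (back-injective σ) r (back-fixed σ fix))
    from : IsIsolatedFixedPoint encode (inject₂ j) → Even j × IsFixedPoint (σ ⟨$⟩ʳ_) j
    from iso =
      let r , e = firstAbove-encode {j} (Equivalence.from (iso _) refl) in
      e , inject₂-injective (Equivalence.to (iso _) (encode-forth e))

  fixedPoint⇔oddMaximum :
    (Odd j × IsFixedPoint (σ ⟨$⟩ʳ_) j) ⇔ IsOddMaximum {suc n} encode (inject₂ j)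
  fixedPoint⇔oddMaximum {j} = mk⇔
    (λ (odd , fix) → odd ∘ even-inject₂ , label-inject₂-≤ j ,
       trans (cong label (special-encode (back-fixed σ fix) odd)) label-top)
    (λ (_ , _ , eq) → let fix , odd = encode-special (label-top⁻¹ eq) in odd , forth-fixed σ fix)

-- The D-permutation of a staircase.

module _ (n : ℕ) (S : StaircaseWithoutEvenMaxima (suc n)) where

  private
    f = proj₁ S
    excedent = proj₁ (proj₁ (proj₂ S))
    image = proj₂ (proj₁ (proj₂ S))
    noEvenMaximum = proj₂ (proj₂ S)

  ordinary-≤ : f (inject₂ i) ≡ inject₂ x → i Fin.≤ x
  ordinary-≤ {i} {x} eq = subst₂ _≤_ (toℕ-inject₂ i) (toℕ-inject₂ x)
    (s≤s⁻¹ (subst (λ v → label (inject₂ i) ≤ label v) eq (excedent (inject₂ i))))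

  ¬pretop : f i ≢ pretop
  ¬pretop eq = pretop-odd n (Equivalence.to (image _) (_ , eq))

  ordinary-value : suc (n * 2) ≤ label i → f i ≢ inject₂ x
  ordinary-value {i} {x} le eq = ℕ.<-irrefl refl (ℕ.≤-trans le (ℕ.≤-trans
    (subst (λ v → label i ≤ label v) eq (excedent i)) (label-inject₂-≤ x)))

  -- By excedence the value is one of the two added points, and `pretop` is odd, hence outside the
  -- image.
  f-late : suc (n * 2) ≤ label i → f i ≡ top
  f-late {i} le with f i in eq
  ... | v with cover v
  ...   | isTop = refl
  ...   | isPre = contradiction eq ¬pretop
  ...   | old x = contradiction eq (ordinary-value le)

  f-top : f top ≡ top
  f-top = f-late (ℕ.≤-trans (ℕ.n≤1+n _) (ℕ.≤-reflexive (sym label-top)))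

  f-pretop : f pretop ≡ top
  f-pretop = f-late (ℕ.≤-reflexive (sym label-pretop))

  f-value : ∀ i → (f (inject₂ i) ≡ top × Odd i) ⊎ ∃ λ x → f (inject₂ i) ≡ inject₂ x × Even x
  f-value i with f (inject₂ i) in eq
  ... | v with cover v
  ...   | isPre = contradiction eq ¬pretop
  ...   | old x = inj₂ (x , refl , even-inject₂ (Equivalence.to (image _) (_ , eq)))
  -- An even point with value `top` would be an even maximum.
  ...   | isTop = inj₁ (refl , λ e → noEvenMaximum (inject₂ i)
                    (inject₂-even e , label-inject₂-≤ i , trans (cong label eq) label-top))

  f-surjective : ∀ x → Even x → ∃ λ i → f (inject₂ i) ≡ inject₂ x
  f-surjective x e with Equivalence.from (image (inject₂ x)) (inject₂-even e)
  ... | i , eq with cover i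
  ...   | old j = j , eq
  ...   | isPre = contradiction (trans (sym eq) f-pretop) inject₂≢top
  ...   | isTop = contradiction (trans (sym eq) f-top) inject₂≢top

  decodedD : DPermutation n
  decodedD = decoded ordinary-≤ f-value f-surjective , decoded-D ordinary-≤ f-value f-surjective

  decodedD-code : ∀ k → Code (proj₁ decodedD ⟨$⟩ˡ_) k (f (inject₂ k))
  decodedD-code = decode-code ordinary-≤ f-value f-surjective

-- The bijection.

-- Every staircase sends both added points to `top`, so the codes at the old points determine it.
encode-agrees : ∀ n (D : DPermutation n) (S : StaircaseWithoutEvenMaxima (suc n)) →
                (∀ k → Code (proj₁ D ⟨$⟩ˡ_) k (proj₁ S (inject₂ k))) → encode n D ≗ proj₁ S
encode-agrees n D S codes i with cover i
... | old k = code-unique (λ _ → refl) (encode-code n D k) (codes k)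
... | isPre = trans (f-pretop n (staircase n D)) (sym (f-pretop n S))
... | isTop = trans (f-top n (staircase n D)) (sym (f-top n S))

lemma5p2 : (n : ℕ) → 1 ≤ n →
    Σ (Bijection (DPermutationSetoid n) (StaircaseWithoutEvenMaximaSetoid (suc n))) λ φ →
    ∀ (σ : DPermutation n) (j : Fin (n * 2)) →
    ((Even j × IsCycleMaximum (proj₁ σ) j) ⇔
    IsFixedPoint (proj₁ (Bijection.to φ σ)) (embed {n} j))
    × ((Even j × IsFixedPoint (proj₁ σ ⟨$⟩ʳ_) j) ⇔
    IsIsolatedFixedPoint (proj₁ (Bijection.to φ σ)) (embed {n} j))
    × ((Odd j × IsFixedPoint (proj₁ σ ⟨$⟩ʳ_) j) ⇔
    IsOddMaximum {suc n} (proj₁ (Bijection.to φ σ)) (embed {n} j))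
lemma5p2 n _ = φ , λ D j →
  cycleMaximum⇔fixedPoint n D , fixedPoint⇔isolated n D , fixedPoint⇔oddMaximum n D
  where
  -- Equality of D-permutations concerns forward values, whereas codes concern the inverse;
  -- uniqueness of codes carries them across.
  recode : ∀ (D E : DPermutation n) → (proj₁ D ⟨$⟩ʳ_) ≗ (proj₁ E ⟨$⟩ʳ_) →
           ∀ {k v} → Code (proj₁ E ⟨$⟩ˡ_) k v → Code (proj₁ D ⟨$⟩ˡ_) k v
  recode D E eq {k} {v} c = subst (Code _ k)
    (code-unique (back-cong (proj₁ D) (proj₁ E) eq) (proj₂ (value n D k)) c) (proj₂ (value n D k))

  φ : Bijection (DPermutationSetoid n) (StaircaseWithoutEvenMaximaSetoid (suc n))
  φ = record
    { to        = staircase n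
    ; cong      = λ {D} {E} eq → encode-agrees n D (staircase n E)
                    λ k → recode D E eq (encode-code n E k)
    ; bijective =
        (λ {D} {E} eq → forth-cong (proj₁ D) (proj₁ E)
          (code-injective {f = encode n D ∘ inject₂}
            (back-injective (proj₁ D)) (back-injective (proj₁ E))
            (encode-code n D)
            (λ k → subst (Code _ k) (sym (eq (inject₂ k))) (encode-code n E k))))
      -- Surjectivity between setoids is required for every `D` equal to the decoded permutation.
      , λ S → decodedD n S , λ {D} eq → encode-agrees n D S
          λ k → recode D (decodedD n S) eq (decodedD-code n S k)
    }
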